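{- There do not exist functions $f:(0,1]\to[0,\infty)$ and $g:\{2,3,\dots\}\to[0,\infty)$ with $f(\varepsilon)=o(1/\varepsilon^2)$ as $\varepsilon\downarrow0$ such that for every $\varepsilon\in(0,1]$ and every $k\ge2$ there is a deterministic algorithm for $k$ servers on the real line that is $(1+\varepsilon)$-consistent and $(f(\varepsilon)+g(k))$-robust. In particular, robustness $O(1/\varepsilon)+O(\log k)$ is impossible for $(1+\varepsilon)$-consistent deterministic algorithms.
   Context: Online metric matching with action predictions on the real line. There are $k$ labelled servers $S$ at fixed points of $\mathbb R$ (labels stay distinct even if locations coincide), known in advance; an algorithm must handle every placement of the $k$ servers on $\mathbb R$. Requests $r_1,\dots,r_k\in\mathbb R$ arrive one by one; request $r_t$ arrives together with a predicted server $p_t\in S$, visible before the algorithm acts. Each request must be matched immediately and irrevocably to a currently free server $w$, at cost $|r_t-w|$. $\mathrm{cost}$ is the total cost of the algorithm, and $\mathrm{OPT}$ is the minimum cost of an offline perfect matching of requests to servers. A prediction sequence is perfect if some offline optimal matching $M^*$ has $p_t=M^*(r_t)$ for every $t$. A deterministic algorithm is $c$-consistent if $\mathrm{cost}\le c\cdot\mathrm{OPT}$ on every instance with a perfect prediction sequence, and $r$-robust if $\mathrm{cost}\le r\cdot\mathrm{OPT}$ on every instance, with arbitrary predictions (when $\mathrm{OPT}=0$ both require cost $0$). -}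

module Defs where

open import Algebra.Bundles using (CommutativeRing)
open import Algebra.Structures using (IsCommutativeRing)
open import Data.Fin.Base as Fin using (Fin; toℕ)
open import Data.Fin.Permutation using (Permutation′; _⟨$⟩ʳ_)
open import Data.List.Base as List using (List)
open import Data.Nat.Base as ℕ using (ℕ)
open import Data.Nat.Logarithm using (⌈log₂_⌉)
open import Data.Product.Base using (_×_; _,_; ∃; ∃-syntax; proj₁; proj₂)
open import Data.Refinement using (Refinement-syntax; value)
open import Data.Sum.Base using ([_,_]′)
open import Data.Vec.Base using (Vec; lookup; toList)
open import Function.Base using (const)
open import Relation.Binary.Core using (Rel)
open import Relation.Binary.Structures using (IsDecTotalOrder)
open import Relation.Binary.PropositionalEquality.Core using (_≡_; _≢_)
import Algebra.Definitions.RawMonoid as RawMonoidDefs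
import Relation.Binary.Construct.NonStrictToStrict as ToStrict

-- The real numbers, given by the axioms of a Dedekind-complete ordered field
-- (unique up to isomorphism).  The order is decidable, as it is classically,
-- so an online algorithm may branch on comparisons.
record RealNumbers : Set₁ where
  infix  8 -_
  infixl 7 _*_
  infixl 6 _+_
  infix  4 _≤_
  field
    ℝ         : Set
    _+_ _*_   : ℝ → ℝ → ℝ
    -_        : ℝ → ℝ
    0# 1#     : ℝ
    _⁻¹       : ℝ → ℝ
    _≤_       : Rel ℝ _
    isCommutativeRing : IsCommutativeRing _≡_ _+_ _*_ -_ 0# 1#
    0≢1               : 0# ≢ 1#
    -- nothing is assumed about 0# ⁻¹
    *-inverseʳ        : ∀ x → x ≢ 0# → x * x ⁻¹ ≡ 1#
    ≤-isDecTotalOrder : IsDecTotalOrder _≡_ _≤_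
    +-monoʳ-≤         : ∀ z {x y} → x ≤ y → z + x ≤ z + y
    *-nonNeg          : ∀ {x y} → 0# ≤ x → 0# ≤ y → 0# ≤ x * y

  UpperBound : (ℝ → Set) → ℝ → Set
  UpperBound P b = ∀ x → P x → x ≤ b

  field
    supremum : (P : ℝ → Set) → ∃ P → ∃ (UpperBound P) →
               ∃[ s ] UpperBound P s × (∀ b → UpperBound P b → s ≤ b)

  open ToStrict _≡_ _≤_ public using (_<_)

  commutativeRing : CommutativeRing _ _
  commutativeRing = record { isCommutativeRing = isCommutativeRing }

  open CommutativeRing commutativeRing public using (_-_; +-rawMonoid)

  open RawMonoidDefs +-rawMonoid public using (sum) renaming (_×_ to _·_)

  fromℕ : ℕ → ℝ
  fromℕ n = n · 1#

  ∣_∣ : ℝ → ℝ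
  ∣ x ∣ = [ const x , const (- x) ]′ (IsDecTotalOrder.total ≤-isDecTotalOrder 0# x)

  ⟨0,1] : Set
  ⟨0,1] = [ ε ∈ ℝ ∣ 0# < ε × ε ≤ 1# ]

  ℝ≥0 : Set
  ℝ≥0 = [ x ∈ ℝ ∣ 0# ≤ x ]

ℕ≥2 : Set
ℕ≥2 = [ k ∈ ℕ ∣ 2 ℕ.≤ k ]

module _ (R : RealNumbers) where
  open RealNumbers R

  -- A request together with the server predicted for it.
  Request : ℕ → Set
  Request k = ℝ × Fin k

  -- Servers are labelled by Fin k; their locations may coincide.
  record Instance (k : ℕ) : Set where
    constructor _▹_
    field
      servers  : Vec ℝ k
      requests : Vec (Request k) k

    server : Fin k → ℝ
    server = lookup servers

    request : Fin k → ℝ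
    request t = proj₁ (lookup requests t)

    prediction : Fin k → Fin k
    prediction t = proj₂ (lookup requests t)

    -- The requests that arrived strictly before time t, in order of arrival.
    history : Fin k → List (Request k)
    history t = List.take (toℕ t) (toList requests)

    assignmentCost : (Fin k → Fin k) → ℝ
    assignmentCost σ = sum λ t → ∣ request t - server (σ t) ∣

    matchingCost : Permutation′ k → ℝ
    matchingCost M = assignmentCost (M ⟨$⟩ʳ_)

    IsOptimal : Permutation′ k → Set
    IsOptimal M = ∀ M′ → matchingCost M ≤ matchingCost M′

    IsOPT : ℝ → Set
    IsOPT v = ∃[ M ] IsOptimal M × v ≡ matchingCost M

    PerfectPredictions : Set
    PerfectPredictions = ∃[ M ] IsOptimal M × (∀ t → prediction t ≡ M ⟨$⟩ʳ t)

  open Instance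

  -- A deterministic online algorithm: the server for the current request is a
  -- function of the server locations, the earlier requests and predictions, and
  -- the current request and prediction.  (Earlier choices are themselves
  -- determined by these data.)
  record OnlineAlgorithm (k : ℕ) : Set where
    field
      decide : (servers : Vec ℝ k) (past : List (Request k)) (now : Request k) → Fin k

    assign : Instance k → Fin k → Fin k
    assign I t = decide (servers I) (history I t) (lookup (requests I) t)

    field
      free : ∀ I {t u} → t Fin.< u → assign I u ≢ assign I t

    cost : Instance k → ℝ
    cost I = assignmentCost I (assign I)

  open OnlineAlgorithm

  Consistent : ∀ {k} → ℝ → OnlineAlgorithm k → Set
  Consistent c A = ∀ I opt → PerfectPredictions I → IsOPT I opt → cost A I ≤ c * opt

  Robust : ∀ {k} → ℝ → OnlineAlgorithm k → Set
  Robust r A = ∀ I opt → IsOPT I opt → cost A I ≤ r * opt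

  Achievable : (⟨0,1] → ℝ≥0) → (ℕ≥2 → ℝ≥0) → Set
  Achievable f g = ∀ ε k → ∃[ A ] Consistent {value k} (1# + value ε) A
                                × Robust (value (f ε) + value (g k)) A

  -- f(ε) = o(1/ε²) as ε ↓ 0
  LittleO[1/ε²] : (⟨0,1] → ℝ≥0) → Set
  LittleO[1/ε²] f = ∀ c → 0# < c → ∃[ δ ] 0# < δ ×
    (∀ ε → value ε < δ → value (f ε) ≤ c * (value ε * value ε) ⁻¹)

  -- f(ε) = O(1/ε) as ε ↓ 0
  BigO[1/ε] : (⟨0,1] → ℝ≥0) → Set
  BigO[1/ε] f = ∃[ C ] ∃[ δ ] 0# < δ ×
    (∀ ε → value ε < δ → value (f ε) ≤ C * (value ε) ⁻¹)

  -- g(k) = O(log k) as k → ∞.  Since log₂ k ≤ ⌈log₂ k⌉ ≤ 2 log₂ k for k ≥ 2,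
  -- rounding and the base of the logarithm only affect the constant C.
  BigO[logk] : (ℕ≥2 → ℝ≥0) → Set
  BigO[logk] g = ∃[ C ] ∃[ K ]
    (∀ k → K ℕ.≤ value k → value (g k) ≤ C * fromℕ ⌈log₂ value k ⌉)

{-# OPTIONS --safe #-}

-- Fix k = 3 and ε = 1/M, and put the servers at a = 0, b = 1 + M and
-- c = 1 + M + M².  The first request is at 1, predicted b.  If the next ones came
-- at c and a with perfect predictions, OPT would be M and any first choice other
-- than b would cost more than M + 1 = (1 + ε) M; so the algorithm takes b.  The
-- second request is at b, predicted c.  If the last one came at a, OPT would be
-- M + M² and using a would cost 2 + 3M + M² > (1 + ε)(M + M²); so the algorithm
-- takes c.  The last request then comes at c: the algorithm pays 1 + 2M + 2M²,
-- whereas OPT = 1.  Hence f(ε) + g(3) ≥ 2/ε² for all small ε.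
module Submission where

open import Defs
open import Algebra.Bundles using (CommutativeRing)
open import Data.Fin.Base as Fin using (Fin; zero; suc)
import Data.Fin.Properties as Fin using (_≟_)
open import Data.Fin.Patterns using (0F; 1F; 2F)
open import Data.Fin.Permutation as Perm using (Permutation′; _⟨$⟩ʳ_)
open import Data.Irrelevant using ([_])
open import Data.Nat.Base as ℕ using (ℕ; s≤s; z≤n)
open import Data.Product.Base using (_×_; _,_; ∃₂; proj₁; proj₂)
open import Data.Refinement using (value; _,_)
open import Data.Sum.Base using (inj₁; inj₂)
open import Data.Vec.Base using (Vec; []; _∷_; lookup)
open import Data.Vec.Functional using (Vector)
open import Function.Base using (_∘_)
open import Relation.Binary.Bundles using (DecTotalOrder)
open import Relation.Binary.PropositionalEquality
  using (_≡_; _≢_; refl; sym; trans; cong; cong₂; subst; subst₂)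
open import Relation.Nullary.Decidable.Core using (Dec; recompute; decidable-stable)
open import Relation.Nullary.Negation.Core using (¬_; contradiction)
import Algebra.Construct.NaturalChoice.Max as Max
import Algebra.Construct.NaturalChoice.Min as Min
import Algebra.Properties.AbelianGroup as AbelianGroupProperties
import Algebra.Properties.CommutativeMonoid.Sum as CommutativeMonoidSum
import Algebra.Properties.Ring as RingProperties
import Algebra.Solver.Ring.NaturalCoefficients.Default as RingSolver
import Relation.Binary.Construct.NonStrictToStrict as ToStrict
import Relation.Binary.Properties.DecTotalOrder as OrderProperties
import Relation.Binary.Reasoning.PartialOrder as OrderReasoning

-- Arithmetic, order and inverses in an ordered field.

module OrderedField (R : RealNumbers) where
  open RealNumbers R
  open CommutativeRing commutativeRing public using
    ( +-comm; +-assoc; +-identityˡ; +-identityʳ; -‿inverseˡ; -‿inverseʳ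
    ; *-comm; *-assoc; *-identityˡ; *-identityʳ; zeroˡ; zeroʳ
    ; distribˡ; +-abelianGroup; +-commutativeMonoid; commutativeSemiring; ring )
  open AbelianGroupProperties +-abelianGroup using (⁻¹-anti-homo‿-; //-rightDividesˡ)
  open RingProperties ring using (-0#≈0#; -‿distribʳ-*; -‿involutive; +-cancelˡ; +-cancelʳ)
  open CommutativeMonoidSum +-commutativeMonoid public using (sum-permute; ∑-distrib-+)

  ≤-decTotalOrder : DecTotalOrder _ _ _
  ≤-decTotalOrder = record { isDecTotalOrder = ≤-isDecTotalOrder }

  open DecTotalOrder ≤-decTotalOrder public using (poset; totalOrder; total; _≤?_; _≟_)
    renaming (refl to ≤-refl; reflexive to ≤-reflexive; trans to ≤-trans; antisym to ≤-antisym)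
  open OrderProperties ≤-decTotalOrder public using (≰⇒>; <⇒≱)
  open OrderReasoning poset public
  open Max totalOrder public using (_⊔_; x≤x⊔y; x≤y⊔x)
  open Min totalOrder public using (_⊓_; x⊓y≤x; x⊓y≤y; ⊓-sel)
  open RingSolver commutativeSemiring public using (solve; _:+_; _:*_; _:=_)

  <⇒≤ : ∀ {x y} → x < y → x ≤ y
  <⇒≤ = proj₁

  _<?_ : ∀ x y → Dec (x < y)
  _<?_ = ToStrict.<-decidable _≡_ _≤_ _≟_ _≤?_

  +-mono-≤ : ∀ {x y u v} → x ≤ y → u ≤ v → x + u ≤ y + v
  +-mono-≤ {x} {y} {u} {v} x≤y u≤v = begin
    x + u  ≤⟨ +-monoʳ-≤ x u≤v ⟩
    x + v  ≡⟨ +-comm x v ⟩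
    v + x  ≤⟨ +-monoʳ-≤ v x≤y ⟩
    v + y  ≡⟨ +-comm v y ⟩
    y + v  ∎

  +-monoʳ-< : ∀ z {x y} → x < y → z + x < z + y
  +-monoʳ-< z (x≤y , x≢y) = +-monoʳ-≤ z x≤y , x≢y ∘ +-cancelˡ z _ _

  +-cancelʳ-≤ : ∀ z {x y} → x + z ≤ y + z → x ≤ y
  +-cancelʳ-≤ z {x} {y} x+z≤y+z = begin
    x              ≡⟨ cancel x ⟨
    (- z) + (x + z)  ≤⟨ +-monoʳ-≤ (- z) x+z≤y+z ⟩
    (- z) + (y + z)  ≡⟨ cancel y ⟩
    y              ∎
    where
    cancel : ∀ w → (- z) + (w + z) ≡ w
    cancel w = trans (cong (- z +_) (+-comm w z)) (trans (sym (+-assoc (- z) z w))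
      (trans (cong (_+ w) (-‿inverseˡ z)) (+-identityˡ w)))

  +-nonNeg : ∀ {x y} → 0# ≤ x → 0# ≤ y → 0# ≤ x + y
  +-nonNeg 0≤x 0≤y = ≤-trans (≤-reflexive (sym (+-identityˡ 0#))) (+-mono-≤ 0≤x 0≤y)

  x≤x+y : ∀ {x y} → 0# ≤ y → x ≤ x + y
  x≤x+y {x} 0≤y = ≤-trans (≤-reflexive (sym (+-identityʳ x))) (+-monoʳ-≤ x 0≤y)

  x≤y+x : ∀ {x y} → 0# ≤ y → x ≤ y + x
  x≤y+x {x} {y} 0≤y = ≤-trans (x≤x+y 0≤y) (≤-reflexive (+-comm x y))

  neg-nonNeg : ∀ {x} → x ≤ 0# → 0# ≤ - x
  neg-nonNeg {x} x≤0 = begin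
    0#        ≡⟨ -‿inverseˡ x ⟨
    - x + x   ≤⟨ +-monoʳ-≤ (- x) x≤0 ⟩
    - x + 0#  ≡⟨ +-identityʳ (- x) ⟩
    - x       ∎

  *-monoʳ-≤ : ∀ {z x y} → 0# ≤ z → x ≤ y → z * x ≤ z * y
  *-monoʳ-≤ {z} {x} {y} 0≤z x≤y = begin
    z * x                      ≤⟨ x≤x+y (*-nonNeg 0≤z 0≤y-x) ⟩
    z * x + z * (- x + y)      ≡⟨ distribˡ z x (- x + y) ⟨
    z * (x + (- x + y))        ≡⟨ cong (z *_) (+-assoc x (- x) y) ⟨
    z * ((x + - x) + y)        ≡⟨ cong (λ w → z * (w + y)) (-‿inverseʳ x) ⟩
    z * (0# + y)               ≡⟨ cong (z *_) (+-identityˡ y) ⟩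
    z * y                      ∎
    where
    0≤y-x : 0# ≤ - x + y
    0≤y-x = ≤-trans (≤-reflexive (sym (-‿inverseˡ x))) (+-monoʳ-≤ (- x) x≤y)

  *-monoˡ-≤ : ∀ {z x y} → 0# ≤ z → x ≤ y → x * z ≤ y * z
  *-monoˡ-≤ {z} {x} {y} 0≤z x≤y =
    subst₂ _≤_ (*-comm z x) (*-comm z y) (*-monoʳ-≤ 0≤z x≤y)

  0≤1 : 0# ≤ 1#
  0≤1 with total 0# 1#
  ... | inj₁ 0≤1 = 0≤1
  ... | inj₂ 1≤0 = begin
    0#             ≤⟨ *-nonNeg (neg-nonNeg 1≤0) (neg-nonNeg 1≤0) ⟩
    - 1# * - 1#    ≡⟨ -‿distribʳ-* (- 1#) 1# ⟨
    - (- 1# * 1#)  ≡⟨ cong -_ (*-identityʳ (- 1#)) ⟩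
    - - 1#         ≡⟨ -‿involutive 1# ⟩
    1#             ∎

  0<1 : 0# < 1#
  0<1 = 0≤1 , 0≢1

  x<1+x : ∀ {x} → x < 1# + x
  x<1+x {x} = subst₂ _<_ (+-identityʳ x) (+-comm x 1#) (+-monoʳ-< x 0<1)

  pos⇒≢0 : ∀ {x} → 0# < x → x ≢ 0#
  pos⇒≢0 (_ , 0≢x) = 0≢x ∘ sym

  *-inverseˡ : ∀ x → x ≢ 0# → x ⁻¹ * x ≡ 1#
  *-inverseˡ x x≢0 = trans (*-comm (x ⁻¹) x) (*-inverseʳ x x≢0)

  -- Nothing is known about the inverse of zero, so `x ≢ 0#` is extracted first: `x ≡ 0#` would turn
  -- the hypothesis into `0# ≡ 1#`.
  ⁻¹-unique : ∀ {x y} → x * y ≡ 1# → x ⁻¹ ≡ y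
  ⁻¹-unique {x} {y} xy≡1 = begin-equality
    x ⁻¹              ≡⟨ *-identityʳ (x ⁻¹) ⟨
    x ⁻¹ * 1#         ≡⟨ cong (x ⁻¹ *_) xy≡1 ⟨
    x ⁻¹ * (x * y)    ≡⟨ *-assoc (x ⁻¹) x y ⟨
    x ⁻¹ * x * y      ≡⟨ cong (_* y) (*-inverseˡ x x≢0) ⟩
    1# * y            ≡⟨ *-identityˡ y ⟩
    y                 ∎
    where
    x≢0 : x ≢ 0#
    x≢0 x≡0 = 0≢1 (trans (sym (zeroˡ y)) (trans (cong (_* y) (sym x≡0)) xy≡1))

  square-⁻¹ : ∀ {x y} → x * y ≡ 1# → (x * x) ⁻¹ ≡ y * y
  square-⁻¹ {x} {y} xy≡1 = ⁻¹-unique (begin-equality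
    x * x * (y * y)    ≡⟨ solve 2 (λ x y → x :* x :* (y :* y) := x :* y :* (x :* y)) refl x y ⟩
    x * y * (x * y)    ≡⟨ cong₂ _*_ xy≡1 xy≡1 ⟩
    1# * 1#            ≡⟨ *-identityʳ 1# ⟩
    1#                 ∎)

  ⁻¹-pos : ∀ {x} → 0# < x → 0# < x ⁻¹
  ⁻¹-pos {x} 0<x = ≰⇒> λ x⁻¹≤0 → <⇒≱ 0<1 (begin
    1#          ≡⟨ *-inverseʳ x (pos⇒≢0 0<x) ⟨
    x * x ⁻¹    ≤⟨ *-monoʳ-≤ (<⇒≤ 0<x) x⁻¹≤0 ⟩
    x * 0#      ≡⟨ zeroʳ x ⟩
    0#          ∎)

  -- By contraposition: multiplying `x ≤ y ⁻¹` by the positive numbers `y` and `x ⁻¹` gives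
  -- `y ≤ x ⁻¹`. This turns a large `M` into a small `ε`.
  ⁻¹-swap-< : ∀ {x y} → 0# < x → x ⁻¹ < y → y ⁻¹ < x
  ⁻¹-swap-< {x} {y} 0<x x⁻¹<y = ≰⇒> λ x≤y⁻¹ → <⇒≱ x⁻¹<y (begin
    y                ≡⟨ *-identityʳ y ⟨
    y * 1#           ≡⟨ cong (y *_) (*-inverseʳ x (pos⇒≢0 0<x)) ⟨
    y * (x * x ⁻¹)   ≡⟨ *-assoc y x (x ⁻¹) ⟨
    y * x * x ⁻¹     ≤⟨ *-monoˡ-≤ (<⇒≤ (⁻¹-pos 0<x)) (*-monoʳ-≤ (<⇒≤ 0<y) x≤y⁻¹) ⟩
    y * y ⁻¹ * x ⁻¹  ≡⟨ cong (_* x ⁻¹) (*-inverseʳ y (pos⇒≢0 0<y)) ⟩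
    1# * x ⁻¹        ≡⟨ *-identityˡ (x ⁻¹) ⟩
    x ⁻¹             ∎)
    where
    0<y : 0# < y
    0<y = begin-strict
      0#    <⟨ ⁻¹-pos 0<x ⟩
      x ⁻¹  <⟨ x⁻¹<y ⟩
      y     ∎

  -- Absolute values and distances.

  nonNeg⇒∣x∣≡x : ∀ {x} → 0# ≤ x → ∣ x ∣ ≡ x
  nonNeg⇒∣x∣≡x {x} 0≤x with total 0# x
  ... | inj₁ _ = refl
  -- `total` may answer either way at zero, and zero is the only value that reaches this case.
  ... | inj₂ x≤0 with refl ← ≤-antisym 0≤x x≤0 = -0#≈0#

  ∣-x∣≡∣x∣ : ∀ x → ∣ - x ∣ ≡ ∣ x ∣
  ∣-x∣≡∣x∣ x with total 0# x
  ∣-x∣≡∣x∣ x | inj₂ x≤0 = nonNeg⇒∣x∣≡x (neg-nonNeg x≤0)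
  ∣-x∣≡∣x∣ x | inj₁ 0≤x with total 0# (- x)
  ... | inj₂ _ = -‿involutive x
  ... | inj₁ 0≤-x with refl ← ≤-antisym 0≤x (subst (x ≤_) (-‿inverseʳ x) (x≤x+y 0≤-x)) = -0#≈0#

  x≤∣x∣ : ∀ x → x ≤ ∣ x ∣
  x≤∣x∣ x with total 0# x
  ... | inj₁ _ = ≤-refl
  ... | inj₂ x≤0 = ≤-trans x≤0 (neg-nonNeg x≤0)

  0≤∣x∣ : ∀ x → 0# ≤ ∣ x ∣
  0≤∣x∣ x with total 0# x
  ... | inj₁ 0≤x = 0≤x
  ... | inj₂ x≤0 = neg-nonNeg x≤0

  ∣x-y∣≡∣y-x∣ : ∀ x y → ∣ x - y ∣ ≡ ∣ y - x ∣
  ∣x-y∣≡∣y-x∣ x y = trans (cong ∣_∣ (sym (⁻¹-anti-homo‿- y x))) (∣-x∣≡∣x∣ (y - x))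

  -- Written additively so that it can be summed over all requests and the common total cancelled
  -- afterwards; `y≤x⇒∣x-y∣+y≡x` is the equality case.
  x≤∣x-y∣+y : ∀ x y → x ≤ ∣ x - y ∣ + y
  x≤∣x-y∣+y x y = begin
    x              ≡⟨ //-rightDividesˡ y x ⟨
    x - y + y      ≤⟨ +-mono-≤ (x≤∣x∣ (x - y)) ≤-refl ⟩
    ∣ x - y ∣ + y  ∎

  y≤x⇒∣x-y∣+y≡x : ∀ {x y} → y ≤ x → ∣ x - y ∣ + y ≡ x
  y≤x⇒∣x-y∣+y≡x {x} {y} y≤x = trans (cong (_+ y) (nonNeg⇒∣x∣≡x 0≤x-y)) (//-rightDividesˡ y x)
    where
    0≤x-y : 0# ≤ x - y
    0≤x-y = ≤-trans (≤-reflexive (sym (-‿inverseʳ y))) (+-mono-≤ y≤x ≤-refl)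

  -- The certificate `y + d ≡ x` contains no subtraction, so concrete distances reduce to identities
  -- in a semiring.
  ∣x-y∣≡d : ∀ {x y d} → 0# ≤ d → y + d ≡ x → ∣ x - y ∣ ≡ d
  ∣x-y∣≡d {y = y} {d} 0≤d refl = +-cancelʳ _ _ _ (trans (y≤x⇒∣x-y∣+y≡x (x≤x+y 0≤d)) (+-comm y d))

  ∣y-x∣≡d : ∀ {x y d} → 0# ≤ d → y + d ≡ x → ∣ y - x ∣ ≡ d
  ∣y-x∣≡d 0≤d y+d≡x = trans (∣x-y∣≡∣y-x∣ _ _) (∣x-y∣≡d 0≤d y+d≡x)

  ∣x-x∣≡0 : ∀ x → ∣ x - x ∣ ≡ 0#
  ∣x-x∣≡0 x = ∣x-y∣≡d ≤-refl (+-identityʳ x)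

  sum-mono-≤ : ∀ {n} {f h : Vector ℝ n} → (∀ i → f i ≤ h i) → sum f ≤ sum h
  sum-mono-≤ {ℕ.zero}  f≤h = ≤-refl
  sum-mono-≤ {ℕ.suc n} f≤h = +-mono-≤ (f≤h zero) (sum-mono-≤ (f≤h ∘ suc))

-- Optimality of matchings in which all requests lie on the same side of their servers.

module Optimality (R : RealNumbers) {k : ℕ} (I : Instance R k) where
  open RealNumbers R
  open OrderedField R
  open Instance I

  -- Every matching costs at least |Σ servers − Σ requests|; a one-sided one attains this.
  onLeft⇒optimal : ∀ M → (∀ t → request t ≤ server (M ⟨$⟩ʳ t)) → IsOptimal M
  onLeft⇒optimal M r≤s M′ = +-cancelʳ-≤ (sum request) (begin
    matchingCost M + sum request               ≡⟨ ∑-distrib-+ _ request ⟨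
    sum (λ t → dist M t + request t)           ≤⟨ sum-mono-≤ (λ t → ≤-reflexive (exact t)) ⟩
    sum (λ t → server (M ⟨$⟩ʳ t))              ≡⟨ sum-permute server M ⟨
    sum server                                 ≡⟨ sum-permute server M′ ⟩
    sum (λ t → server (M′ ⟨$⟩ʳ t))             ≤⟨ sum-mono-≤ bound ⟩
    sum (λ t → dist M′ t + request t)          ≡⟨ ∑-distrib-+ _ request ⟩
    matchingCost M′ + sum request              ∎)
    where
    dist : Permutation′ k → Fin k → ℝ
    dist N t = ∣ request t - server (N ⟨$⟩ʳ t) ∣

    exact : ∀ t → dist M t + request t ≡ server (M ⟨$⟩ʳ t)
    exact t = trans (cong (_+ request t) (∣x-y∣≡∣y-x∣ _ _)) (y≤x⇒∣x-y∣+y≡x (r≤s t))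

    bound : ∀ t → server (M′ ⟨$⟩ʳ t) ≤ dist M′ t + request t
    bound t = ≤-trans (x≤∣x-y∣+y _ (request t))
      (≤-reflexive (cong (_+ request t) (∣x-y∣≡∣y-x∣ _ _)))

  -- Mirror image of `onLeft⇒optimal`: the server total, which is the same for every matching, is
  -- added to both sides. Distance plus server is then exactly the request for `M` and at least the
  -- request for `M′`.
  onRight⇒optimal : ∀ M → (∀ t → server (M ⟨$⟩ʳ t) ≤ request t) → IsOptimal M
  onRight⇒optimal M s≤r M′ = +-cancelʳ-≤ (sum server) (begin
    matchingCost M + sum server                              ≡⟨ cong (matchingCost M +_) (sum-permute server M) ⟩
    matchingCost M + sum (λ t → server (M ⟨$⟩ʳ t))           ≡⟨ ∑-distrib-+ _ (λ t → server (M ⟨$⟩ʳ t)) ⟨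
    sum (λ t → ∣ request t - server (M ⟨$⟩ʳ t) ∣ + server (M ⟨$⟩ʳ t))
      ≤⟨ sum-mono-≤ (λ t → ≤-reflexive (y≤x⇒∣x-y∣+y≡x (s≤r t))) ⟩
    sum request
      ≤⟨ sum-mono-≤ (λ t → x≤∣x-y∣+y (request t) (server (M′ ⟨$⟩ʳ t))) ⟩
    sum (λ t → ∣ request t - server (M′ ⟨$⟩ʳ t) ∣ + server (M′ ⟨$⟩ʳ t))
      ≡⟨ ∑-distrib-+ _ (λ t → server (M′ ⟨$⟩ʳ t)) ⟩
    matchingCost M′ + sum (λ t → server (M′ ⟨$⟩ʳ t))         ≡⟨ cong (matchingCost M′ +_) (sum-permute server M′) ⟨
    matchingCost M′ + sum server                             ∎)

-- The adversary on three servers.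

module LowerBound (R : RealNumbers) {M : RealNumbers.ℝ R}
  (1<M : RealNumbers._<_ R (RealNumbers.1# R) M) where

  open RealNumbers R
  open OrderedField R

  b c : ℝ
  b = 1# + M
  c = b + M * M

  0≤M : 0# ≤ M
  0≤M = ≤-trans 0≤1 (<⇒≤ 1<M)

  M≤M*M : M ≤ M * M
  M≤M*M = subst (_≤ M * M) (*-identityʳ M) (*-monoʳ-≤ 0≤M (<⇒≤ 1<M))

  0≤M*M : 0# ≤ M * M
  0≤M*M = *-nonNeg 0≤M 0≤M

  1≤b : 1# ≤ b
  1≤b = x≤x+y 0≤M

  b≤c : b ≤ c
  b≤c = x≤x+y 0≤M*M

  0≤b : 0# ≤ b
  0≤b = ≤-trans 0≤1 1≤b

  0≤c : 0# ≤ c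
  0≤c = ≤-trans 0≤b b≤c

  servers : Vec ℝ 3
  servers = 0# ∷ b ∷ c ∷ []

  -- All three carry the predictions of `rotation`. Because of the common prefixes, the first
  -- decision is definitionally the same on all three instances, and the second on `I₂` and `I₃`.
  I₁ I₂ I₃ : Instance R 3
  I₁ = servers ▹ ((1# , 1F) ∷ (c , 2F) ∷ (0# , 0F) ∷ [])
  I₂ = servers ▹ ((1# , 1F) ∷ (b , 2F) ∷ (0# , 0F) ∷ [])
  I₃ = servers ▹ ((1# , 1F) ∷ (b , 2F) ∷ (c , 0F) ∷ [])

  -- 0F ↦ 1F ↦ 2F ↦ 0F
  rotation : Permutation′ 3
  rotation = Perm.insert 2F 0F Perm.id

  rotation-optimal₁ : Instance.IsOptimal I₁ rotation
  rotation-optimal₁ = Optimality.onLeft⇒optimal R I₁ rotation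
    λ { 0F → 1≤b ; 1F → ≤-refl ; 2F → ≤-refl }

  rotation-optimal₂ : Instance.IsOptimal I₂ rotation
  rotation-optimal₂ = Optimality.onLeft⇒optimal R I₂ rotation
    λ { 0F → 1≤b ; 1F → b≤c ; 2F → ≤-refl }

  id-optimal₃ : Instance.IsOptimal I₃ Perm.id
  id-optimal₃ = Optimality.onRight⇒optimal R I₃ Perm.id
    λ { 0F → 0≤1 ; 1F → ≤-refl ; 2F → ≤-refl }

  ∣1-0∣ : ∣ 1# - 0# ∣ ≡ 1#
  ∣1-0∣ = ∣x-y∣≡d 0≤1 (+-identityˡ 1#)

  ∣1-b∣ : ∣ 1# - b ∣ ≡ M
  ∣1-b∣ = ∣y-x∣≡d 0≤M refl

  ∣1-c∣ : ∣ 1# - c ∣ ≡ M + M * M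
  ∣1-c∣ = ∣y-x∣≡d (+-nonNeg 0≤M 0≤M*M) (sym (+-assoc 1# M (M * M)))

  ∣b-0∣ : ∣ b - 0# ∣ ≡ b
  ∣b-0∣ = ∣x-y∣≡d 0≤b (+-identityˡ b)

  ∣b-c∣ : ∣ b - c ∣ ≡ M * M
  ∣b-c∣ = ∣y-x∣≡d 0≤M*M refl

  ∣0-b∣ : ∣ 0# - b ∣ ≡ b
  ∣0-b∣ = ∣y-x∣≡d 0≤b (+-identityˡ b)

  ∣0-c∣ : ∣ 0# - c ∣ ≡ c
  ∣0-c∣ = ∣y-x∣≡d 0≤c (+-identityˡ c)

  ∣c-0∣ : ∣ c - 0# ∣ ≡ c
  ∣c-0∣ = ∣x-y∣≡d 0≤c (+-identityˡ c)

  -- The trailing `0#` is the empty tail left when `sum` over `Fin 3` unfolds.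
  sum₃ : ∀ {x y z x′ y′ z′} → x ≡ x′ → y ≡ y′ → z ≡ z′ → x + (y + (z + 0#)) ≡ x′ + (y′ + z′)
  sum₃ refl refl refl = cong (λ w → _ + (_ + w)) (+-identityʳ _)

  OPT₁ : Instance.matchingCost I₁ rotation ≡ M
  OPT₁ = trans (sum₃ ∣1-b∣ (∣x-x∣≡0 c) (∣x-x∣≡0 0#))
    (trans (cong (M +_) (+-identityʳ 0#)) (+-identityʳ M))

  OPT₂ : Instance.matchingCost I₂ rotation ≡ M + M * M
  OPT₂ = trans (sum₃ ∣1-b∣ ∣b-c∣ (∣x-x∣≡0 0#)) (cong (M +_) (+-identityʳ (M * M)))

  OPT₃ : Instance.matchingCost I₃ Perm.id ≡ 1#
  OPT₃ = trans (sum₃ ∣1-0∣ (∣x-x∣≡0 b) (∣x-x∣≡0 c))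
    (trans (cong (1# +_) (+-identityʳ 0#)) (+-identityʳ 1#))

  -- Each inequality puts the later choice first, as `free` supplies it.
  Distinct : Fin 3 → Fin 3 → Fin 3 → Set
  Distinct i j l = j ≢ i × l ≢ i × l ≢ j

  -- The left side is the budget `(1 + ε) M`. Starting with server 0 sends the last request, at 0,
  -- to `b` or farther, for at least `1 + b` in all; starting with `c` already costs `M + M²`. The
  -- choice `j` contributes only a nonnegative term. The assignment is a `lookup` so that its
  -- entries can be split and rewritten.
  cost₁ : ∀ i j l → Distinct i j l → i ≢ 1F →
    M + 1# < Instance.assignmentCost I₁ (lookup (i ∷ j ∷ l ∷ []))
  cost₁ 1F _ _ _ i≢1 = contradiction refl i≢1
  cost₁ 0F _ 0F (_ , l≢i , _) _ = contradiction refl l≢i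
  cost₁ 0F j (suc l) _ _ = begin-strict
    M + 1#                                            ≡⟨ +-comm M 1# ⟩
    b                                                 <⟨ x<1+x ⟩
    1# + b                                            ≤⟨ +-monoʳ-≤ 1# (far l) ⟩
    1# + ∣ 0# - lookup servers (suc l) ∣              ≤⟨ +-monoʳ-≤ 1# (x≤y+x (0≤∣x∣ _)) ⟩
    1# + (∣ c - lookup servers j ∣ + ∣ 0# - lookup servers (suc l) ∣)
      ≡⟨ sum₃ ∣1-0∣ refl refl ⟨
    Instance.assignmentCost I₁ (lookup (0F ∷ j ∷ suc l ∷ []))  ∎
    where
    far : ∀ l → b ≤ ∣ 0# - lookup servers (suc l) ∣
    far 0F = ≤-reflexive (sym ∣0-b∣)
    far 1F = ≤-trans b≤c (≤-reflexive (sym ∣0-c∣))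
  cost₁ 2F j l _ _ = begin-strict
    M + 1#                                            <⟨ +-monoʳ-< M 1<M ⟩
    M + M                                             ≤⟨ +-monoʳ-≤ M M≤M*M ⟩
    M + M * M                                         ≤⟨ x≤x+y (+-nonNeg (0≤∣x∣ _) (0≤∣x∣ _)) ⟩
    M + M * M + (∣ c - lookup servers j ∣ + ∣ 0# - lookup servers l ∣)
      ≡⟨ sum₃ ∣1-c∣ refl refl ⟨
    Instance.assignmentCost I₁ (lookup (2F ∷ j ∷ l ∷ []))  ∎

  -- With `b` taken, the only alternative to `c` is server 0, and then the request at 0 must go to
  -- `c`. The total `M + b + c` exceeds the budget by `1 + M`.
  cost₂ : ∀ j l → Distinct 1F j l → j ≢ 2F →
    M + M * M + (1# + M) < Instance.assignmentCost I₂ (lookup (1F ∷ j ∷ l ∷ []))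
  cost₂ 1F _ (j≢i , _) _ = contradiction refl j≢i
  cost₂ 2F _ _ j≢2 = contradiction refl j≢2
  cost₂ 0F 0F (_ , _ , l≢j) _ = contradiction refl l≢j
  cost₂ 0F 1F (_ , l≢i , _) _ = contradiction refl l≢i
  cost₂ 0F 2F _ _ = begin-strict
    M + M * M + b                <⟨ x<1+x ⟩
    1# + (M + M * M + b)         ≤⟨ x≤x+y 0≤M ⟩
    1# + (M + M * M + b) + M
      ≡⟨ solve 2 (λ e m → e :+ (m :+ m :* m :+ (e :+ m)) :+ m := m :+ ((e :+ m) :+ (e :+ m :+ m :* m))) refl 1# M ⟩
    M + (b + c)                  ≡⟨ sum₃ ∣1-b∣ ∣b-0∣ ∣0-c∣ ⟨
    Instance.assignmentCost I₂ (lookup (1F ∷ 0F ∷ 2F ∷ []))  ∎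

  -- Only server 0 is left for the request at `c`. Of the total `1 + 2M + 2M²` the bound keeps `M²`,
  -- to be set against `f`, and `M`, to be set against `g`.
  cost₃ : ∀ l → Distinct 1F 2F l →
    M * M + M < Instance.assignmentCost I₃ (lookup (1F ∷ 2F ∷ l ∷ []))
  cost₃ 1F (_ , l≢i , _) = contradiction refl l≢i
  cost₃ 2F (_ , _ , l≢j) = contradiction refl l≢j
  cost₃ 0F _ = begin-strict
    M * M + M              <⟨ x<1+x ⟩
    1# + (M * M + M)       ≤⟨ x≤x+y (+-nonNeg 0≤M 0≤M*M) ⟩
    1# + (M * M + M) + (M + M * M)
      ≡⟨ solve 2 (λ e m → e :+ (m :* m :+ m) :+ (m :+ m :* m) := m :+ (m :* m :+ (e :+ m :+ m :* m))) refl 1# M ⟩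
    M + (M * M + c)        ≡⟨ sum₃ ∣1-b∣ ∣b-c∣ ∣c-0∣ ⟨
    Instance.assignmentCost I₃ (lookup (1F ∷ 2F ∷ 0F ∷ []))  ∎

  -- Decisions forced by consistency and the resulting robustness bound.

  module _ {ε r : ℝ} (ε*M≡1 : ε * M ≡ 1#) (A : OnlineAlgorithm R 3)
           (consistent : Consistent R (1# + ε) A) (robust : Robust R r A) where
    open OnlineAlgorithm A

    distinct : ∀ I → Distinct (assign I 0F) (assign I 1F) (assign I 2F)
    distinct I = free I (s≤s z≤n) , free I (s≤s z≤n) , free I (s≤s (s≤s z≤n))

    consistent₁ : cost I₁ ≤ M + 1#
    consistent₁ = begin
      cost I₁         ≤⟨ consistent I₁ M (rotation , rotation-optimal₁ , λ { 0F → refl ; 1F → refl ; 2F → refl })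
                                         (rotation , rotation-optimal₁ , sym OPT₁) ⟩
      (1# + ε) * M    ≡⟨ solve 3 (λ e x m → (e :+ x) :* m := e :* m :+ x :* m) refl 1# ε M ⟩
      1# * M + ε * M  ≡⟨ cong₂ _+_ (*-identityˡ M) ε*M≡1 ⟩
      M + 1#          ∎

    consistent₂ : cost I₂ ≤ M + M * M + (1# + M)
    consistent₂ = begin
      cost I₂
        ≤⟨ consistent I₂ (M + M * M) (rotation , rotation-optimal₂ , λ { 0F → refl ; 1F → refl ; 2F → refl })
                                     (rotation , rotation-optimal₂ , sym OPT₂) ⟩
      (1# + ε) * (M + M * M)
        -- Expanded so that `ε` occurs only within `ε * M`, which is 1.
        ≡⟨ solve 3 (λ e x m → (e :+ x) :* (m :+ m :* m) := e :* (m :+ m :* m) :+ (x :* m :+ x :* m :* m)) refl 1# ε M ⟩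
      1# * (M + M * M) + (ε * M + ε * M * M)
        ≡⟨ cong₂ (λ x y → x + (y + y * M)) (*-identityˡ _) ε*M≡1 ⟩
      M + M * M + (1# + 1# * M)
        ≡⟨ cong (λ x → M + M * M + (1# + x)) (*-identityˡ M) ⟩
      M + M * M + (1# + M)  ∎

    assign-0F : assign I₁ 0F ≡ 1F
    assign-0F = decidable-stable (_ Fin.≟ _) λ i≢1 →
      <⇒≱ (cost₁ _ _ _ (distinct I₁) i≢1) consistent₁

    -- `assign-0F` speaks of `I₁` but rewrites the first choice on `I₂`, since both are the same
    -- call of `decide`. Any second choice other than `c` then breaks the budget of `cost₂`.
    assign-1F : assign I₂ 1F ≡ 2F
    assign-1F = decidable-stable (_ Fin.≟ _) λ j≢2 →
      <⇒≱ (cost₂ _ _ (subst (λ i → Distinct i (assign I₂ 1F) (assign I₂ 2F)) assign-0F (distinct I₂)) j≢2)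
          (subst (λ i → Instance.assignmentCost I₂ (lookup (i ∷ assign I₂ 1F ∷ assign I₂ 2F ∷ [])) ≤ _) assign-0F consistent₂)

    robustness-bound : M * M + M < r
    robustness-bound = begin-strict
      M * M + M                        <⟨ cost₃ _ (subst₂ (λ i j → Distinct i j (assign I₃ 2F)) assign-0F assign-1F (distinct I₃)) ⟩
      Instance.assignmentCost I₃ (lookup (1F ∷ 2F ∷ assign I₃ 2F ∷ []))
        ≡⟨ cong₂ (λ i j → Instance.assignmentCost I₃ (lookup (i ∷ j ∷ assign I₃ 2F ∷ []))) assign-0F assign-1F ⟨
      -- The optimum of `I₃` is 1, so the cost is bounded by the ratio `r` itself.
      cost I₃                          ≤⟨ robust I₃ 1# (Perm.id , id-optimal₃ , sym OPT₃) ⟩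
      r * 1#                           ≡⟨ *-identityʳ r ⟩
      r                                ∎

-- From the three-server bound to the asymptotic statements.

module _ (R : RealNumbers) where
  open RealNumbers R
  open OrderedField R

  -- `C/ε` equals `Cε/ε²`, and `Cε ≤ c` once `ε` is below `c` over a positive upper bound of `C`.
  BigO[1/ε]⇒LittleO[1/ε²] : ∀ f → BigO[1/ε] R f → LittleO[1/ε²] R f
  BigO[1/ε]⇒LittleO[1/ε²] f (C , δ , 0<δ , f≤C/ε) c 0<c = δ ⊓ c/D , 0<δ⊓c/D , bound
    where
    D c/D : ℝ
    -- `C` may be zero or negative; `D` dominates it and can be divided by.
    D = 1# ⊔ C
    c/D = c * D ⁻¹

    0<D : 0# < D
    0<D = begin-strict
      0#  <⟨ 0<1 ⟩
      1#  ≤⟨ x≤x⊔y 1# C ⟩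
      D   ∎

    D*[c/D]≡c : D * c/D ≡ c
    D*[c/D]≡c = trans (solve 3 (λ d c i → d :* (c :* i) := c :* (d :* i)) refl D c (D ⁻¹))
      (trans (cong (c *_) (*-inverseʳ D (pos⇒≢0 0<D))) (*-identityʳ c))

    0<c/D : 0# < c/D
    0<c/D = *-nonNeg (<⇒≤ 0<c) (<⇒≤ (⁻¹-pos 0<D)) , λ 0≡c/D →
      pos⇒≢0 0<c (trans (sym D*[c/D]≡c) (trans (cong (D *_) (sym 0≡c/D)) (zeroʳ D)))

    0<δ⊓c/D : 0# < δ ⊓ c/D
    0<δ⊓c/D with ⊓-sel δ c/D
    ... | inj₁ ⊓≡δ = subst (0# <_) (sym ⊓≡δ) 0<δ
    ... | inj₂ ⊓≡c/D = subst (0# <_) (sym ⊓≡c/D) 0<c/D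

    bound : ∀ ε → value ε < δ ⊓ c/D → value (f ε) ≤ c * (value ε * value ε) ⁻¹
    bound ε@(x , [ 0<x×x≤1 ]) x<δ⊓c/D = begin
      value (f ε)         ≤⟨ f≤C/ε ε x<δ ⟩
      C * x ⁻¹            ≤⟨ *-monoˡ-≤ 0≤x⁻¹ (x≤y⊔x 1# C) ⟩
      D * x ⁻¹            ≡⟨ *-identityʳ _ ⟨
      D * x ⁻¹ * 1#       ≡⟨ cong (D * x ⁻¹ *_) x*x⁻¹≡1 ⟨
      D * x ⁻¹ * (x * x ⁻¹)
        ≡⟨ solve 3 (λ d x i → d :* i :* (x :* i) := d :* x :* (i :* i)) refl D x (x ⁻¹) ⟩
      D * x * (x ⁻¹ * x ⁻¹)  ≤⟨ *-monoˡ-≤ (*-nonNeg 0≤x⁻¹ 0≤x⁻¹) D*x≤c ⟩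
      c * (x ⁻¹ * x ⁻¹)   ≡⟨ cong (c *_) (square-⁻¹ x*x⁻¹≡1) ⟨
      c * (x * x) ⁻¹      ∎
      where
      0<x : 0# < x
      -- The bounds on `ε` are stored irrelevantly; decidability of the order recovers a usable
      -- proof.
      0<x = recompute (0# <? x) (proj₁ 0<x×x≤1)

      x*x⁻¹≡1 : x * x ⁻¹ ≡ 1#
      x*x⁻¹≡1 = *-inverseʳ x (pos⇒≢0 0<x)

      0≤x⁻¹ : 0# ≤ x ⁻¹
      0≤x⁻¹ = <⇒≤ (⁻¹-pos 0<x)

      x<δ : x < δ
      x<δ = begin-strict
        x        <⟨ x<δ⊓c/D ⟩
        δ ⊓ c/D  ≤⟨ x⊓y≤x δ c/D ⟩
        δ        ∎

      D*x≤c : D * x ≤ c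
      D*x≤c = begin
        D * x          ≤⟨ *-monoʳ-≤ (<⇒≤ 0<D) (<⇒≤ x<δ⊓c/D) ⟩
        D * (δ ⊓ c/D)  ≤⟨ *-monoʳ-≤ (<⇒≤ 0<D) (x⊓y≤y δ c/D) ⟩
        D * c/D        ≡⟨ D*[c/D]≡c ⟩
        c              ∎

  -- With `k` fixed at 3, `g` contributes a constant. The little-o bound at constant 1 gives
  -- `f(ε) ≤ M²` for `ε = 1/M`, and a large `M` also exceeds `g(3)`, so the claimed ratio is at most
  -- `M² + M`, against `robustness-bound`.
  LittleO⇒¬Achievable : ∀ f g → LittleO[1/ε²] R f → ¬ Achievable R f g
  LittleO⇒¬Achievable f g f≪1/ε² achievable
    = <⇒≱ (robustness-bound ε*M≡1 A consistent robust) (begin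
      value (f ε) + value (g k)     ≤⟨ +-mono-≤ (f≤1/ε² ε ε<δ) g≤M ⟩
      1# * (M ⁻¹ * M ⁻¹) ⁻¹ + M     ≡⟨ cong (_+ M) (*-identityˡ _) ⟩
      (M ⁻¹ * M ⁻¹) ⁻¹ + M          ≡⟨ cong (_+ M) (square-⁻¹ ε*M≡1) ⟩
      M * M + M                     ∎)
    where
    δ = proj₁ (f≪1/ε² 1# 0<1)
    0<δ = proj₁ (proj₂ (f≪1/ε² 1# 0<1))
    f≤1/ε² = proj₂ (proj₂ (f≪1/ε² 1# 0<1))

    k : ℕ≥2
    k = 3 , [ s≤s (s≤s z≤n) ]

    B M : ℝ
    -- The three terms provide `1 < M`, `g(3) ≤ M` and `ε < δ`; adding 1 in `M` makes the first and
    -- last strict.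
    B = 1# ⊔ (value (g k) ⊔ δ ⁻¹)
    M = 1# + B

    1<M : 1# < M
    1<M = begin-strict
      1#  ≤⟨ x≤x⊔y 1# _ ⟩
      B   <⟨ x<1+x ⟩
      M   ∎

    g≤M : value (g k) ≤ M
    g≤M = begin
      value (g k)           ≤⟨ x≤x⊔y _ _ ⟩
      value (g k) ⊔ δ ⁻¹    ≤⟨ x≤y⊔x _ _ ⟩
      B                     ≤⟨ <⇒≤ x<1+x ⟩
      M                     ∎

    δ⁻¹<M : δ ⁻¹ < M
    δ⁻¹<M = begin-strict
      δ ⁻¹                  ≤⟨ x≤y⊔x _ _ ⟩
      value (g k) ⊔ δ ⁻¹    ≤⟨ x≤y⊔x _ _ ⟩
      B                     <⟨ x<1+x ⟩
      M                     ∎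

    0<M : 0# < M
    0<M = begin-strict
      0#  <⟨ 0<1 ⟩
      1#  <⟨ 1<M ⟩
      M   ∎

    ε*M≡1 : M ⁻¹ * M ≡ 1#
    ε*M≡1 = *-inverseˡ M (pos⇒≢0 0<M)

    ε≤1 : M ⁻¹ ≤ 1#
    ε≤1 = <⇒≤ (⁻¹-swap-< 0<1 (subst (_< M) (sym (⁻¹-unique (*-identityʳ 1#))) 1<M))

    ε : ⟨0,1]
    ε = M ⁻¹ , [ ⁻¹-pos 0<M , ε≤1 ]

    ε<δ : M ⁻¹ < δ
    ε<δ = ⁻¹-swap-< 0<δ δ⁻¹<M

    A = proj₁ (achievable ε k)
    consistent = proj₁ (proj₂ (achievable ε k))
    robust = proj₂ (proj₂ (achievable ε k))

    open LowerBound R 1<M using (robustness-bound)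

corollary3 : (R : RealNumbers) →
    ¬ (∃₂ λ f g → LittleO[1/ε²] R f × Achievable R f g)
    × ¬ (∃₂ λ f g → BigO[1/ε] R f × BigO[logk] R g × Achievable R f g)
corollary3 R =
    (λ (f , g , f≪1/ε² , achievable) → LittleO⇒¬Achievable R f g f≪1/ε² achievable)
  , (λ (f , g , f≲1/ε , _ , achievable) →
      LittleO⇒¬Achievable R f g (BigO[1/ε]⇒LittleO[1/ε²] R f f≲1/ε) achievable)
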